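{- Let $\mathcal{CS}$ be an axiomatically appropriate constant specification and $y$ an individual variable. For every finite set $X$ of individual variables with $y\notin X$, every formula $\varphi(y)$ and every justification term $t$, there are justification terms $f(t)$ and $s(t)$ such that (1) $\vdash_{\mathcal{CS}} t{:}_X\forall y\varphi(y)\to\forall y\, f(t){:}_{Xy}\varphi(y)$, and (2) $\vdash_{\mathcal{CS}} \exists y\, t{:}_{Xy}\varphi(y)\to s(t){:}_X\exists y\varphi(y)$.
   Context: Syntax of FOLPb: terms $t::=p_i\mid c\mid (t\cdot t)\mid (t+t)\mid !t\mid\mathsf b(t)\mid\mathsf{gen}_x(t)$; formulas $Px_1\dots x_n\mid\bot\mid\varphi\to\varphi\mid\forall x\varphi\mid t{:}_X\varphi$ with $X$ a finite set of individual variables; the free variables of $t{:}_X\psi$ are exactly those in $X$. $Xy$ denotes $X\cup\{y\}$ with $y\notin X$. Axioms of $\mathsf{FOLPb}_0$: A1 classical first-order axioms; A2 $t{:}_{Xy}\varphi\to t{:}_X\varphi$ if $y$ not free in $\varphi$; A3 $t{:}_X\varphi\to t{:}_{Xy}\varphi$; B1 $t{:}_X\varphi\to\varphi$; B2 $t{:}_X(\varphi\to\psi)\to(s{:}_X\varphi\to[t\cdot s]{:}_X\psi)$; B3 $t{:}_X\varphi\to[t+s]{:}_X\varphi$, $s{:}_X\varphi\to[t+s]{:}_X\varphi$; B4 $t{:}_X\varphi\to!t{:}_Xt{:}_X\varphi$; B5 $t{:}_X\varphi\to\mathsf{gen}_x(t){:}_X\forall x\varphi$ if $x\notin X$; Bb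 $\forall y\,t{:}_{Xy}\varphi(y)\to\mathsf b(t){:}_X\forall y\varphi(y)$; rules modus ponens and generalization. A constant specification $\mathcal{CS}$ is a set of formulas $c{:}\psi$ ($\psi$ an axiom, $c$ a constant); it is axiomatically appropriate if for every axiom $\psi$ some $c{:}\psi\in\mathcal{CS}$. $\vdash_{\mathcal{CS}}$ is provability in $\mathsf{FOLPb}_0$ with $\mathcal{CS}$ added as axioms. -}

module Defs where

open import Level using (Level)
open import Data.Empty using (⊥)
open import Data.List.Fresh using (List#; []; cons; _#_)
open import Data.List.Fresh.Relation.Unary.Any using (any?)
open import Data.Nat.Base using (ℕ; _<_)
open import Data.Nat.Properties using (<-cmp; <-trans; _≟_)
open import Data.Product.Base using (_×_; _,_; ∃-syntax)
open import Data.Sum.Base using (_⊎_)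
open import Data.Unit.Base using (⊤)
open import Data.Vec.Base as Vec using (Vec)
import Data.Vec.Membership.Propositional as Vec
open import Relation.Binary.Definitions using (tri<; tri≈; tri>)
open import Relation.Binary.PropositionalEquality using (_≡_; _≢_; setoid)
open import Relation.Nullary using (¬_; Dec; yes; no)
open import Relation.Unary using (Pred)

Var : Set
Var = ℕ

open import Data.List.Fresh.Membership.Setoid (setoid Var) public using (_∈_; _∉_)

-- Finite sets of variables as strictly increasing lists: each finite set has
-- exactly one representative, so t:_X φ depends only on the set X.
VarSet : Set
VarSet = List# Var _<_

_∈?_ : (x : Var) (X : VarSet) → Dec (x ∈ X)
x ∈? X = any? (x ≟_) X

∅ : VarSet
∅ = []

#-trans : ∀ {x y} (X : VarSet) → x < y → y # X → x # X
#-trans []           _   _             = _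
#-trans (cons _ X _) x<y (y<z , y#X) = <-trans x<y y<z , #-trans X x<y y#X

infixl 20 _∪⁅_⁆

_∪⁅_⁆ : VarSet → Var → VarSet
#-∪⁅⁆ : ∀ {x y} (X : VarSet) → x < y → x # X → x # (X ∪⁅ y ⁆)

[] ∪⁅ y ⁆ = cons y [] _
cons x X x#X ∪⁅ y ⁆ with <-cmp y x
... | tri< y<x _ _ = cons y (cons x X x#X) (y<x , #-trans X y<x x#X)
... | tri≈ _ _ _   = cons x X x#X
... | tri> _ _ x<y = cons x (X ∪⁅ y ⁆) (#-∪⁅⁆ X x<y x#X)

#-∪⁅⁆ [] x<y _ = x<y , _
#-∪⁅⁆ {x} {y} (cons z X z#X) x<y (x<z , x#X) with <-cmp y z
... | tri< _ _ _ = x<y , x<z , x#X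
... | tri≈ _ _ _ = x<z , x#X
... | tri> _ _ _ = x<z , #-∪⁅⁆ X x<y x#X

record Language : Set₁ where
  field
    PredSym : Set
    arity   : PredSym → ℕ
    Const   : Set

open Language public

private variable
  ℓ : Level
  L : Language

infixl 10 _·_
infixl 9  _⊕_

data Term (L : Language) : Set where
  pvar : ℕ → Term L
  con  : Const L → Term L
  _·_  : Term L → Term L → Term L
  _⊕_  : Term L → Term L → Term L
  !_   : Term L → Term L
  b    : Term L → Term L
  gen  : Var → Term L → Term L

infixr 5 _⇒_
infix  7 _∶[_]_

data Formula (L : Language) : Set where
  atom   : (P : PredSym L) → Vec Var (arity L P) → Formula L
  ⊥′     : Formula L
  _⇒_    : Formula L → Formula L → Formula L
  All    : Var → Formula L → Formula L
  _∶[_]_ : Term L → VarSet → Formula L → Formula L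

∼_ : Formula L → Formula L
∼ φ = φ ⇒ ⊥′

Ex : Var → Formula L → Formula L
Ex x φ = ∼ All x (∼ φ)

_∈FV_ : Var → Formula L → Set
x ∈FV atom P xs    = x Vec.∈ xs
x ∈FV ⊥′           = ⊥
x ∈FV (φ ⇒ ψ)      = x ∈FV φ ⊎ x ∈FV ψ
x ∈FV All y φ      = x ≢ y × x ∈FV φ
x ∈FV (t ∶[ X ] φ) = x ∈ X

_∉FV_ : Var → Formula L → Set
x ∉FV φ = ¬ (x ∈FV φ)

renameVar : (x z : Var) → Var → Var
renameVar x z v with v ≟ x
... | yes _ = z
... | no  _ = v

renameSet : (x z : Var) → VarSet → VarSet
renameSet x z []           = []
renameSet x z (cons v X _) = renameSet x z X ∪⁅ renameVar x z v ⁆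

-- φ [ z / x ] replaces the free occurrences of x in φ by z.  The prefix t:_X
-- binds every variable outside X; in particular x in gen_x(t) is not a free
-- occurrence, so terms are left unchanged.
_[_/_] : Formula L → Var → Var → Formula L
atom P xs    [ z / x ] = atom P (Vec.map (renameVar x z) xs)
⊥′           [ z / x ] = ⊥′
(φ ⇒ ψ)      [ z / x ] = φ [ z / x ] ⇒ ψ [ z / x ]
All y φ      [ z / x ] with x ≟ y
... | yes _ = All y φ
... | no  _ = All y (φ [ z / x ])
(t ∶[ X ] φ) [ z / x ] with x ∈? X
... | yes _ = t ∶[ renameSet x z X ] (φ [ z / x ])
... | no  _ = t ∶[ X ] φ

-- FreeFor z x φ: z is free for x in φ.  In t:_X φ with x ∈ X, the variable z
-- enters the index set, so a free z of φ not in X, bound before the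
-- substitution, would become free; this is excluded.
FreeFor : (z x : Var) → Formula L → Set
FreeFor z x (atom P xs)    = ⊤
FreeFor z x ⊥′             = ⊤
FreeFor z x (φ ⇒ ψ)        = FreeFor z x φ × FreeFor z x ψ
FreeFor z x (All y φ)      = x ∉FV All y φ ⊎ (z ≢ y × FreeFor z x φ)
FreeFor z x (t ∶[ X ] φ)   = x ∉ X ⊎ ((z ∈ X ⊎ z ∉FV φ) × FreeFor z x φ)

-- A1 is a standard Hilbert axiomatisation of classical first-order logic over
-- ⊥, ⇒, ∀ with modus ponens and generalization as rules.
data Axiom {L : Language} : Formula L → Set where
  A1-K    : ∀ {φ ψ} → Axiom (φ ⇒ ψ ⇒ φ)
  A1-S    : ∀ {φ ψ χ} → Axiom ((φ ⇒ ψ ⇒ χ) ⇒ (φ ⇒ ψ) ⇒ φ ⇒ χ)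
  A1-DN   : ∀ {φ} → Axiom (∼ (∼ φ) ⇒ φ)
  A1-inst : ∀ {x z φ} → FreeFor z x φ → Axiom (All x φ ⇒ φ [ z / x ])
  A1-dist : ∀ {x φ ψ} → x ∉FV φ → Axiom (All x (φ ⇒ ψ) ⇒ φ ⇒ All x ψ)
  A2  : ∀ {t X y φ} → y ∉ X → y ∉FV φ → Axiom (t ∶[ X ∪⁅ y ⁆ ] φ ⇒ t ∶[ X ] φ)
  A3  : ∀ {t X y φ} → y ∉ X → Axiom (t ∶[ X ] φ ⇒ t ∶[ X ∪⁅ y ⁆ ] φ)
  B1  : ∀ {t X φ} → Axiom (t ∶[ X ] φ ⇒ φ)
  B2  : ∀ {t s X φ ψ} → Axiom (t ∶[ X ] (φ ⇒ ψ) ⇒ s ∶[ X ] φ ⇒ (t · s) ∶[ X ] ψ)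
  B3ˡ : ∀ {t s X φ} → Axiom (t ∶[ X ] φ ⇒ (t ⊕ s) ∶[ X ] φ)
  B3ʳ : ∀ {t s X φ} → Axiom (s ∶[ X ] φ ⇒ (t ⊕ s) ∶[ X ] φ)
  B4  : ∀ {t X φ} → Axiom (t ∶[ X ] φ ⇒ (! t) ∶[ X ] (t ∶[ X ] φ))
  B5  : ∀ {t x X φ} → x ∉ X → Axiom (t ∶[ X ] φ ⇒ gen x t ∶[ X ] All x φ)
  Bb  : ∀ {t y X φ} → y ∉ X → Axiom (All y (t ∶[ X ∪⁅ y ⁆ ] φ) ⇒ b t ∶[ X ] All y φ)

-- c:ψ without an index set abbreviates c:_∅ ψ.
IsConstantSpecification : Pred (Formula L) ℓ → Set ℓ
IsConstantSpecification {L = L} CS =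
  ∀ χ → CS χ → ∃[ c ] ∃[ ψ ] (Axiom {L} ψ × χ ≡ con c ∶[ ∅ ] ψ)

AxiomaticallyAppropriate : Pred (Formula L) ℓ → Set ℓ
AxiomaticallyAppropriate CS = ∀ ψ → Axiom ψ → ∃[ c ] CS (con c ∶[ ∅ ] ψ)

infix 4 _⊢_

data _⊢_ {L : Language} (CS : Pred (Formula L) ℓ) : Formula L → Set ℓ where
  axiom : ∀ {φ} → Axiom φ → CS ⊢ φ
  spec  : ∀ {φ} → CS φ → CS ⊢ φ
  mp    : ∀ {φ ψ} → CS ⊢ φ ⇒ ψ → CS ⊢ φ → CS ⊢ ψ
  gen   : ∀ {φ} (x : Var) → CS ⊢ φ → CS ⊢ All x φ

{-# OPTIONS --safe #-}
-- For (1), apply a constant for the axiom ∀yφ → φ inside t:_{Xy}; since y ∉ X,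
-- the generalized y is not free in the premise t:_X ∀yφ.  For (2), internalize
-- a proof of φ → ∃yφ; then y can be dropped from Xy by A2, because y is not
-- free in ∃yφ, and the existential in the premise is eliminated classically.
module Submission where

open import Defs
open import Level using (Level)
open import Data.Empty using (⊥-elim)
open import Data.List.Fresh using ([]; cons; _#_)
open import Data.Nat.Properties using (<-cmp; <-irrelevant; <⇒≢; _≟_)
open import Data.Product.Base using (_×_; _,_; ∃-syntax)
open import Data.Sum.Base using (inj₁; inj₂)
open import Data.Vec.Properties using (map-cong; map-id)
open import Relation.Binary.Definitions using (tri<; tri≈; tri>)
open import Relation.Binary.PropositionalEquality using (_≡_; refl; sym; trans; cong; cong₂; subst; setoid)
open import Relation.Nullary using (yes; no)
open import Relation.Unary using (Pred)
open import Data.List.Fresh.Membership.Setoid.Properties (setoid Var) using (fresh⇒∉)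

#-irrelevant : ∀ {x : Var} (X : VarSet) (p q : x # X) → p ≡ q
#-irrelevant []           _       _         = refl
#-irrelevant (cons y X _) (p , r) (p′ , r′) = cong₂ _,_ (<-irrelevant p p′) (#-irrelevant X r r′)

-- Bridges two ways of adding a variable: the axioms and `renameSet` insert, while recursion on a
-- set exposes `cons`.
∪⁅⁆-# : ∀ {x} (X : VarSet) (x#X : x # X) → X ∪⁅ x ⁆ ≡ cons x X x#X
∪⁅⁆-# []                 _         = refl
∪⁅⁆-# {x} (cons y X y#X) (x<y , _) with <-cmp x y
-- Both sides have the same entries; only the stored freshness proofs could differ, and these are
-- unique.
... | tri< _ _ _    = cong (cons x (cons y X y#X)) (#-irrelevant (cons y X y#X) _ _)
... | tri≈ x≮y _ _  = ⊥-elim (x≮y x<y)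
... | tri> x≮y _ _  = ⊥-elim (x≮y x<y)

renameVar-id : ∀ x v → renameVar x x v ≡ v
renameVar-id x v with v ≟ x
... | yes v≡x = sym v≡x
... | no  _   = refl

renameSet-id : ∀ x X → renameSet x x X ≡ X
renameSet-id x []             = refl
renameSet-id x (cons v X v#X) =
  trans (cong₂ _∪⁅_⁆ (renameSet-id x X) (renameVar-id x v)) (∪⁅⁆-# X v#X)

module _ {L : Language} where

  [/]-id : ∀ x (φ : Formula L) → φ [ x / x ] ≡ φ
  [/]-id x (atom P xs) = cong (atom P) (trans (map-cong (renameVar-id x) xs) (map-id xs))
  [/]-id x ⊥′          = refl
  [/]-id x (φ ⇒ ψ)     = cong₂ _⇒_ ([/]-id x φ) ([/]-id x ψ)
  [/]-id x (All y φ) with x ≟ y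
  ... | yes _ = refl
  ... | no  _ = cong (All y) ([/]-id x φ)
  [/]-id x (t ∶[ X ] φ) with x ∈? X
  ... | yes _ = cong₂ (t ∶[_]_) (renameSet-id x X) ([/]-id x φ)
  ... | no  _ = refl

  -- Nothing is captured: under `All x` no occurrence of `x` is free, and a prefix with `x` in its
  -- index set leaves `x` free.
  freeFor-self : ∀ x (φ : Formula L) → FreeFor x x φ
  freeFor-self x (atom P xs) = _
  freeFor-self x ⊥′          = _
  freeFor-self x (φ ⇒ ψ)     = freeFor-self x φ , freeFor-self x ψ
  freeFor-self x (All y φ) with x ≟ y
  ... | yes x≡y = inj₁ λ (x≢y , _) → x≢y x≡y
  ... | no  x≢y = inj₂ (x≢y , freeFor-self x φ)
  freeFor-self x (t ∶[ X ] φ) with x ∈? X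
  ... | yes x∈X = inj₂ (inj₁ x∈X , freeFor-self x φ)
  ... | no  x∉X = inj₁ x∉X

  All-elim : ∀ y (φ : Formula L) → Axiom (All y φ ⇒ φ)
  All-elim y φ = subst (λ ψ → Axiom (All y φ ⇒ ψ)) ([/]-id y φ) (A1-inst (freeFor-self y φ))

module _ {ℓ : Level} {L : Language} {CS : Pred (Formula L) ℓ} where

  private variable
    φ ψ χ : Formula L

  ⇒-const : CS ⊢ φ → CS ⊢ ψ ⇒ φ
  ⇒-const = mp (axiom A1-K)

  ⇒-ap : CS ⊢ φ ⇒ ψ ⇒ χ → CS ⊢ φ ⇒ ψ → CS ⊢ φ ⇒ χ
  ⇒-ap p q = mp (mp (axiom A1-S) p) q

  ⇒-trans : CS ⊢ φ ⇒ ψ → CS ⊢ ψ ⇒ χ → CS ⊢ φ ⇒ χ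
  ⇒-trans p q = ⇒-ap (⇒-const q) p

  ⇒-flip : CS ⊢ φ ⇒ ψ ⇒ χ → CS ⊢ ψ ⇒ φ ⇒ χ
  ⇒-flip p = ⇒-trans (axiom A1-K) (mp (axiom A1-S) p)

  contraposition : CS ⊢ φ ⇒ ψ → CS ⊢ ∼ ψ ⇒ ∼ φ
  -- A1-K followed by A1-S yields `∼ ψ ⇒ (φ ⇒ ψ) ⇒ ∼ φ`.
  contraposition p = ⇒-ap (⇒-trans (axiom A1-K) (axiom A1-S)) (⇒-const p)

  All-intro : ∀ y → y ∉FV φ → CS ⊢ φ ⇒ ψ → CS ⊢ φ ⇒ All y ψ
  All-intro y y∉φ p = mp (axiom (A1-dist y∉φ)) (gen y p)

  Ex-intro : ∀ y φ → CS ⊢ φ ⇒ Ex y φ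
  Ex-intro y φ = ⇒-flip (axiom (All-elim y (∼ φ)))

  Ex-elim : ∀ y → y ∉FV ψ → CS ⊢ φ ⇒ ψ → CS ⊢ Ex y φ ⇒ ψ
  -- Contraposing, generalizing to `∼ ψ ⇒ All y (∼ φ)` and contraposing again leaves a double
  -- negation of `ψ`.
  Ex-elim y y∉ψ p = ⇒-trans (contraposition (All-intro y y∉∼ψ (contraposition p))) (axiom A1-DN)
    where
    y∉∼ψ : y ∉FV (∼ _)
    y∉∼ψ (inj₁ y∈ψ) = y∉ψ y∈ψ

  ∶-weaken : ∀ {t} X → CS ⊢ t ∶[ ∅ ] φ → CS ⊢ t ∶[ X ] φ
  ∶-weaken [] p = p
  ∶-weaken {φ = φ} {t = t} (cons x X x#X) p =
    -- The head lies strictly below every entry of the tail, which gives the side condition of A3.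
    subst (λ Y → CS ⊢ t ∶[ Y ] φ) (∪⁅⁆-# X x#X) (mp (axiom (A3 (fresh⇒∉ <⇒≢ x#X))) (∶-weaken X p))

  ∶-map : ∀ {r t X} → CS ⊢ r ∶[ ∅ ] (φ ⇒ ψ) → CS ⊢ t ∶[ X ] φ ⇒ (r · t) ∶[ X ] ψ
  ∶-map {X = X} p = mp (axiom B2) (∶-weaken X p)

  module _ (isCS : IsConstantSpecification CS) (appropriate : AxiomaticallyAppropriate CS) where

    -- Induction on the derivation, each rule being mirrored by a term operation. Only the empty
    -- index set is treated; `∶-weaken` supplies the others.
    internalize : CS ⊢ φ → ∃[ r ] (CS ⊢ r ∶[ ∅ ] φ)
    internalize (axiom a) = let c , c∈CS = appropriate _ a in con c , spec c∈CS
    -- A specified formula is itself of the form `con c ∶[ ∅ ] ψ`, so B4 justifies it.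
    internalize (spec φ∈CS) with isCS _ φ∈CS
    ... | c , _ , _ , refl = ! con c , mp (axiom B4) (spec φ∈CS)
    internalize (mp p q) =
      let r , p′ = internalize p
          s , q′ = internalize q
      in r · s , mp (mp (axiom B2) p′) q′
    -- With an empty index set the side condition of B5 is vacuous.
    internalize (gen x p) = let r , p′ = internalize p in gen x r , mp (axiom (B5 λ ())) p′

mainTheorem5 : ∀ {ℓ : Level} (L : Language) (CS : Pred (Formula L) ℓ) →
    IsConstantSpecification CS → AxiomaticallyAppropriate CS →
    (y : Var) (X : VarSet) → y ∉ X → (φ : Formula L) (t : Term L) →
    ∃[ f ] ∃[ s ]
    ((CS ⊢ t ∶[ X ] All y φ ⇒ All y (f ∶[ X ∪⁅ y ⁆ ] φ)) ×
    (CS ⊢ Ex y (t ∶[ X ∪⁅ y ⁆ ] φ) ⇒ s ∶[ X ] Ex y φ))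
mainTheorem5 L CS isCS appropriate y X y∉X φ t =
  -- `r` and `q` are built from `y` and `φ` alone, uniformly in `t` and `X`.
  let r , ⊢r = internalize isCS appropriate (axiom (All-elim y φ))
      q , ⊢q = internalize isCS appropriate (Ex-intro y φ)
  in r · t , q · t ,
     All-intro y y∉X (⇒-trans (axiom (A3 y∉X)) (∶-map ⊢r)) ,
     -- The free variables of the conclusion are exactly `X`, so `y∉X` is also the condition for
     -- eliminating the existential.
     Ex-elim y y∉X (⇒-trans (∶-map ⊢q) (axiom (A2 y∉X y∉Ex)))
  where
  y∉Ex : y ∉FV Ex y φ
  y∉Ex (inj₁ (y≢y , _)) = y≢y refl
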